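{- (i) If $G$ is an $r$-tonal graph, where $r$ is an integer with $0<r\le\lfloor e(G)/2\rfloor$, then ${\rm bal}_r(n,G)=\mathcal{O}(n^{2-\frac1m})$ as $n\to\infty$, where $m=m(G)$ is a positive integer depending only on $G$. In particular, if $G$ is balanceable, then ${\rm bal}(n,G)=\mathcal{O}(n^{2-\frac1m})$ with $m=m(G)$ depending only on $G$. (ii) If $G$ is omnitonal, then ${\rm ot}(n,G)=\mathcal{O}(n^{2-\frac1m})$, where $m=m(G)$ is a positive integer depending only on $G$.
   Context: Graphs are finite and simple; $e(G)=|E(G)|$. A $2$-coloring $E(K_n)=E(R)\cup E(B)$ is a partition of the edges of $K_n$ into red edges (forming $R$) and blue edges (forming $B$). An $(r,b)$-colored copy of $G$ (with $r+b=e(G)$) is a (not necessarily induced) subgraph of $K_n$ isomorphic to $G$ with exactly $r$ red and $b$ blue edges. For $0<r\le\lfloor e(G)/2\rfloor$, ${\rm bal}_r(n,G)$ is the minimum non-negative integer $s$ such that every $2$-coloring with $\min\{e(R),e(B)\}>s$ contains an $(r,e(G)-r)$-colored copy or an $(e(G)-r,r)$-colored copy of $G$. ${\rm bal}(n,G)$ is the minimum non-negative integer $s$ such that every $2$-coloring with $\min\{e(R),e(B)\}>s$ contains a $(\lceil e(G)/2\rceil,\lfloor e(G)/2\rfloor)$-colored or a $(\lfloor e(G)/2\rfloor,\lceil e(G)/2\rceil)$-colored copy of $G$. ${\rm ot}(n,G)$ is the minimum non-negative integer $s$ such that every $2$-coloring with $\min\{e(R),e(B)\}>s$ contains an $(r,b)$-colored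 copy of $G$ for every pair of integers $r,b\ge0$ with $r+b=e(G)$. $G$ is $r$-tonal (respectively balanceable, omnitonal) if for every sufficiently large $n$ the integer ${\rm bal}_r(n,G)$ (respectively ${\rm bal}(n,G)$, ${\rm ot}(n,G)$) exists non-vacuously, that is, it is less than $\lfloor\frac12\binom n2\rfloor$, so that colorings with more than that many edges of each color exist. -}

module Defs where

open import Data.Bool using (Bool; false; not; _∧_; T)
open import Data.Bool.Properties using (T?)
open import Data.Fin using (Fin; _<?_)
open import Data.Fin.Subset using (Subset; _∈_)
open import Data.List using (List; allFin; cartesianProduct; filter; length)
open import Data.Nat using (ℕ; _+_; _*_; _∸_; _^_; _⊓_; _≤_; _<_; ⌊_/2⌋; ⌈_/2⌉)
open import Data.Nat.Combinatorics using (_C_)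
open import Data.Product using (_×_; _,_; ∃; ∃-syntax; proj₁)
open import Data.Sum using (_⊎_)
open import Function.Bundles using (_⤖_; module Bijection)
open import Relation.Binary.PropositionalEquality using (_≡_; _≢_; refl; cong₂)
open import Relation.Nullary.Decidable using (_×-dec_)

record Graph (k : ℕ) : Set where
  field
    adj        : Fin k → Fin k → Bool
    adj-sym    : ∀ i j → adj i j ≡ adj j i
    adj-irrefl : ∀ i → adj i i ≡ false

open Graph public

-- Each edge is listed once, as the pair of its endpoints in increasing order.
edges : ∀ {k} → Graph k → List (Fin k × Fin k)
edges {k} G =
  filter (λ (i , j) → (i <? j) ×-dec T? (adj G i j))
         (cartesianProduct (allFin k) (allFin k))

e : ∀ {k} → Graph k → ℕ
e G = length (edges G)

infixr 7 _∩_

_∩_ : ∀ {k} → Graph k → Graph k → Graph k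
adj        (G ∩ H) i j = adj G i j ∧ adj H i j
adj-sym    (G ∩ H) i j = cong₂ _∧_ (adj-sym G i j) (adj-sym H i j)
adj-irrefl (G ∩ H) i rewrite adj-irrefl G i = refl

record Coloring (n : ℕ) : Set where
  field
    R B       : Graph n
    partition : ∀ i j → i ≢ j → adj B i j ≡ not (adj R i j)

open Coloring public

-- A subgraph of Kₙ. The vertex set is recorded separately from the edges
-- because a subgraph may have isolated vertices.
record Subgraph (n : ℕ) : Set where
  field
    vertices  : Subset n
    graph     : Graph n
    supported : ∀ i j → T (adj graph i j) → i ∈ vertices

open Subgraph public

record _≅_ {k n} (G : Graph k) (H : Subgraph n) : Set where
  field
    bijection : Fin k ⤖ ∃ (_∈ vertices H)
  ι : Fin k → Fin n
  ι u = proj₁ (Bijection.to bijection u)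
  field
    preserves : ∀ u v → adj G u v ≡ adj (graph H) (ι u) (ι v)

ColoredCopy : ∀ {k n} → Graph k → Coloring n → (r b : ℕ) → Set
ColoredCopy G c r b =
  ∃[ H ] G ≅ H × e (graph H ∩ R c) ≡ r × e (graph H ∩ B c) ≡ b

IsMinimum : (ℕ → Set) → ℕ → Set
IsMinimum P s = P s × (∀ t → P t → s ≤ t)

Forces : (n : ℕ) → (Coloring n → Set) → ℕ → Set
Forces n Q s = (c : Coloring n) → s < e (R c) ⊓ e (B c) → Q c

-- The parameters bal_r(n,G), bal(n,G) and ot(n,G) are given by their graphs:
-- e.g. Balᵣ r G n s says that bal_r(n,G) exists and equals s.
Balᵣ : ∀ {k} → ℕ → Graph k → ℕ → ℕ → Set
Balᵣ r G n = IsMinimum (Forces n λ c →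
  ColoredCopy G c r (e G ∸ r) ⊎ ColoredCopy G c (e G ∸ r) r)

Bal : ∀ {k} → Graph k → ℕ → ℕ → Set
Bal G n = IsMinimum (Forces n λ c →
  ColoredCopy G c ⌈ e G /2⌉ ⌊ e G /2⌋ ⊎ ColoredCopy G c ⌊ e G /2⌋ ⌈ e G /2⌉)

Ot : ∀ {k} → Graph k → ℕ → ℕ → Set
Ot G n = IsMinimum (Forces n λ c →
  ∀ r b → r + b ≡ e G → ColoredCopy G c r b)

EventuallyNonVacuous : (ℕ → ℕ → Set) → Set
EventuallyNonVacuous F =
  ∃[ N ] ∀ n → N ≤ n → ∃[ s ] F n s × s < ⌊ n C 2 /2⌋

Tonal : ∀ {k} → ℕ → Graph k → Set
Tonal r G = EventuallyNonVacuous (Balᵣ r G)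

Balanceable : ∀ {k} → Graph k → Set
Balanceable G = EventuallyNonVacuous (Bal G)

Omnitonal : ∀ {k} → Graph k → Set
Omnitonal G = EventuallyNonVacuous (Ot G)

-- F(n) = O(n^(2 - 1/m)), for m ≥ 1 and F given by its graph. The inequality
-- s ≤ K n^(2 - 1/m) is raised to the m-th power to stay within ℕ; taking the
-- constant K to be a natural number loses nothing.
O[n^2-1/_] : ℕ → (ℕ → ℕ → Set) → Set
O[n^2-1/ m ] F =
  ∃[ K ] ∃[ N ] ∀ n → N ≤ n →
    ∃[ s ] F n s × s ^ m ≤ K ^ m * n ^ (2 * m ∸ 1)

{-# OPTIONS --safe #-}

-- A coloring with more than K n^(2 - 1/t) edges of each color contains, by
-- Kővári–Sós–Turán, a complete bipartite graph with large sides in each color,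
-- and Ramsey's theorem makes its sides monochromatic. Unless one of these two
-- configurations already uses both colors, there are a large red and a large
-- blue clique, and bipartite Ramsey between them does use both. So the coloring
-- contains one of four patterns on two vertex classes: either the edges inside
-- the first class or the edges between the classes have one color, and all
-- other edges have the opposite color. Conversely, for infinitely many n each
-- pattern exists as a coloring of Kₙ with exactly half of the edges in each
-- color, so tonality of G provides in each pattern a copy of G with the required
-- color counts; as G has k vertices, that copy fits into every pattern whose
-- classes have at least k vertices.
module Submission where

open import Data.Bool using (Bool; true; false; T; not; if_then_else_; _∧_; _xor_)
open import Data.Bool.Properties using (T?; T-∧; T-≡; ∧-comm; xor-comm; not-injective)
open import Data.Empty using (⊥-elim)
open import Data.Fin using (Fin; zero; suc; toℕ; inject≤)
import Data.Fin as Fin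
open import Data.Fin.Properties using (injective⇒≤; any?; suc-injective; inject≤-injective; <-asym; <-cmp)
open import Data.Fin.Subset using (Subset; _∈_)
open import Data.List
  using (List; []; _∷_; _++_; filter; filterᵇ; length; map; cartesianProduct; allFin; lookup; tabulate; take)
open import Data.List.Membership.Propositional using () renaming (_∈_ to _∈ₗ_)
open import Data.List.Membership.Propositional.Properties
  using (∈-lookup; ∈-filter⁺; ∈-filter⁻; ∈-cartesianProduct⁺; ∈-allFin)
open import Data.List.Properties
  using (length-map; map-tabulate; tabulate-cong; filter-≐; filter-++; length-++; length-tabulate; length-take)
open import Data.List.Relation.Binary.Sublist.Propositional
  using (_⊆_; []; _∷_; _∷ʳ_; minimum; ⊆-refl; ⊆-trans)
open import Data.List.Relation.Binary.Sublist.Propositional.Properties using (All-resp-⊆; filter-⊆; take-⊆)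
open import Data.List.Relation.Unary.All as All using (All; []; _∷_)
open import Data.List.Relation.Unary.All.Properties using (all-filter; All-swap)
open import Data.List.Relation.Unary.AllPairs as AllPairs using (AllPairs; []; _∷_)
open import Data.List.Relation.Unary.Any using (index)
open import Data.List.Relation.Unary.Any.Properties using (lookup-index)
open import Data.List.Relation.Unary.Unique.Propositional using (Unique)
import Data.List.Relation.Unary.Unique.Propositional.Properties as Unique
open import Data.Nat hiding (_≟_; <-cmp)
open import Data.Nat.Combinatorics using (_C_; nCk+nC[k+1]≡[n+1]C[k+1]; nC1≡n)
open import Data.Nat.Combinatorics.Base using (_P′_)
open import Data.Nat.Combinatorics.Specification using (nP′k≡n[n∸1P′k∸1])
open import Data.Nat.ListAction using (sum)
open import Data.Nat.Properties hiding (_≟_; suc-injective; <-asym; <-cmp)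
open import Data.Nat.Tactic.RingSolver using (solve-∀)
open import Data.Product using (_×_; _,_; Σ-syntax; ∃-syntax; proj₁; proj₂)
import Data.Sum as Sum
open import Data.Sum using (_⊎_; inj₁; inj₂)
import Data.Vec as Vec
import Data.Vec.Properties as Vec
open import Data.Vec.Properties.WithK using ([]=-irrelevant)
open import Function using (_∘_; id; Equivalence; Injective; _⤖_; mk⤖; module Bijection)
open import Function.Consequences.Propositional using (strictlySurjective⇒surjective)
open import Relation.Binary using (DecidableEquality; Symmetric; tri<; tri≈; tri>)
open import Relation.Binary.PropositionalEquality
  using (_≡_; _≢_; refl; sym; trans; cong; cong₂; subst; ≢-sym)
open import Relation.Nullary using (Dec; yes; no; does)
open import Relation.Nullary.Decidable using (_×-dec_; dec-true; dec-false; ⌊_⌋; toWitness; fromWitness)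
open import Relation.Unary using (Decidable)
open import Defs

open ≤-Reasoning

-- The power mean inequality.

-- With y = x + d and y^k = x^k + D, the two sides differ by d * D.
rearrangement-≤ : ∀ {x y} k → x ≤ y → x * y ^ k + x ^ k * y ≤ x ^ suc k + y ^ suc k
rearrangement-≤ {x} k x≤y with m≤n⇒∃[o]m+o≡n x≤y | m≤n⇒∃[o]m+o≡n (^-monoˡ-≤ k x≤y)
... | d , refl | D , eq rewrite sym eq =
  m+n≤o⇒m≤o _ (≤-reflexive (identity x d (x ^ k) D))
  where
  identity : ∀ x d X D → x * (X + D) + X * (x + d) + d * D ≡ x * X + (x + d) * (X + D)
  identity = solve-∀

rearrangement : ∀ x y k → x * y ^ k + x ^ k * y ≤ x ^ suc k + y ^ suc k
rearrangement x y k with ≤-total x y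
... | inj₁ x≤y = rearrangement-≤ k x≤y
... | inj₂ y≤x = begin
  x * y ^ k + x ^ k * y   ≡⟨ swap x (y ^ k) (x ^ k) y ⟩
  y * x ^ k + y ^ k * x   ≤⟨ rearrangement-≤ k y≤x ⟩
  y ^ suc k + x ^ suc k   ≡⟨ +-comm (y ^ suc k) _ ⟩
  x ^ suc k + y ^ suc k   ∎
  where
  swap : ∀ x Y X y → x * Y + X * y ≡ y * X + Y * x
  swap = solve-∀

^-distribʳ-* : ∀ k m n → (m * n) ^ k ≡ m ^ k * n ^ k
^-distribʳ-* zero    m n = refl
^-distribʳ-* (suc k) m n = trans (cong (m * n *_) (^-distribʳ-* k m n)) (interchange m n (m ^ k) (n ^ k))
  where
  interchange : ∀ m n M N → m * n * (M * N) ≡ m * M * (n * N)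
  interchange = solve-∀

powerSum : ℕ → List ℕ → ℕ
powerSum k xs = sum (map (_^ k) xs)

-- Bounds the cross terms between a new entry and the old list in the induction of `chebyshev`.
rearrangement-sum : ∀ x k xs →
  x * powerSum k xs + x ^ k * sum xs ≤ length xs * x ^ suc k + powerSum (suc k) xs
rearrangement-sum x k [] = ≤-reflexive (cong₂ _+_ (*-zeroʳ x) (*-zeroʳ (x ^ k)))
rearrangement-sum x k (y ∷ ys) = begin
  x * (y ^ k + powerSum k ys) + x ^ k * (y + sum ys)
    ≡⟨ split x (y ^ k) (powerSum k ys) (x ^ k) y (sum ys) ⟩
  (x * y ^ k + x ^ k * y) + (x * powerSum k ys + x ^ k * sum ys)
    ≤⟨ +-mono-≤ (rearrangement x y k) (rearrangement-sum x k ys) ⟩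
  (x ^ suc k + y ^ suc k) + (length ys * x ^ suc k + powerSum (suc k) ys)
    ≡⟨ join (x ^ suc k) (y ^ suc k) (length ys * x ^ suc k) (powerSum (suc k) ys) ⟩
  x ^ suc k + length ys * x ^ suc k + (y ^ suc k + powerSum (suc k) ys) ∎
  where
  split : ∀ x Y P X y s → x * (Y + P) + X * (y + s) ≡ (x * Y + X * y) + (x * P + X * s)
  split = solve-∀
  join : ∀ X Y l P → (X + Y) + (l + P) ≡ X + l + (Y + P)
  join = solve-∀

chebyshev : ∀ k xs → sum xs * powerSum k xs ≤ length xs * powerSum (suc k) xs
chebyshev k [] = z≤n
chebyshev k (x ∷ xs) = begin
  (x + sum xs) * (x ^ k + powerSum k xs)
    ≡⟨ expand x (sum xs) (x ^ k) (powerSum k xs) ⟩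
  x ^ suc k + (x * powerSum k xs + x ^ k * sum xs) + sum xs * powerSum k xs
    ≤⟨ +-mono-≤ (+-monoʳ-≤ (x ^ suc k) (rearrangement-sum x k xs)) (chebyshev k xs) ⟩
  x ^ suc k + (length xs * x ^ suc k + powerSum (suc k) xs) + length xs * powerSum (suc k) xs
    ≡⟨ collect (x ^ suc k) (length xs) (powerSum (suc k) xs) ⟩
  suc (length xs) * (x ^ suc k + powerSum (suc k) xs) ∎
  where
  expand : ∀ x s X P → (x + s) * (X + P) ≡ x * X + (x * P + X * s) + s * P
  expand = solve-∀
  collect : ∀ X l P → X + (l * X + P) + l * P ≡ (1 + l) * (X + P)
  collect = solve-∀

-- Each use of Chebyshev's sum inequality trades one factor `sum xs` for a factor `length xs` and
-- raises the exponent by one.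
power-mean : ∀ k xs → sum xs ^ suc k ≤ length xs ^ k * powerSum (suc k) xs
power-mean zero xs = ≤-reflexive (trans (*-identityʳ _) (trans (first xs) (sym (+-identityʳ _))))
  where
  first : ∀ xs → sum xs ≡ powerSum 1 xs
  first [] = refl
  first (x ∷ xs) = cong₂ _+_ (sym (*-identityʳ x)) (first xs)
power-mean (suc k) xs = begin
  sum xs * sum xs ^ suc k                             ≤⟨ *-monoʳ-≤ (sum xs) (power-mean k xs) ⟩
  sum xs * (length xs ^ k * powerSum (suc k) xs)      ≡⟨ swap (sum xs) (length xs ^ k) _ ⟩
  length xs ^ k * (sum xs * powerSum (suc k) xs)      ≤⟨ *-monoʳ-≤ (length xs ^ k) (chebyshev (suc k) xs) ⟩
  length xs ^ k * (length xs * powerSum (2 + k) xs)   ≡⟨ assoc (length xs ^ k) (length xs) _ ⟩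
  length xs ^ suc k * powerSum (2 + k) xs             ∎
  where
  swap : ∀ s L P → s * (L * P) ≡ L * (s * P)
  swap = solve-∀
  assoc : ∀ L l P → L * (l * P) ≡ (l * L) * P
  assoc = solve-∀

-- Falling factorials.

nP′k≡0 : ∀ {n k} → n < k → n P′ k ≡ 0
nP′k≡0 {n} {suc k} (s≤s n≤k) with m≤n⇒m<n∨m≡n n≤k
... | inj₁ n<k  = trans (cong ((n ∸ k) *_) (nP′k≡0 n<k)) (*-zeroʳ (n ∸ k))
... | inj₂ refl = cong (_* (n P′ n)) (n∸n≡0 n)

-- Injective sequences of length k + 1 either avoid a distinguished element or have it in one of k +
-- 1 positions.
P′-pascal : ∀ n k → suc n P′ suc k ≡ n P′ suc k + suc k * (n P′ k)
P′-pascal n k = trans (nP′k≡n[n∸1P′k∸1] (suc n) (suc k)) factor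
  where
  factor : suc n * (n P′ k) ≡ (n ∸ k) * (n P′ k) + suc k * (n P′ k)
  factor with k ≤? n
  ... | yes k≤n = trans
    (cong (_* (n P′ k)) (sym (trans (+-suc (n ∸ k) k) (cong suc (m∸n+n≡m k≤n)))))
    (*-distribʳ-+ (n P′ k) (n ∸ k) (suc k))
  ... | no k≰n rewrite nP′k≡0 (≰⇒> k≰n) | *-zeroʳ n | *-zeroʳ (n ∸ k) | *-zeroʳ k = refl

nP′k≤n^k : ∀ n k → n P′ k ≤ n ^ k
nP′k≤n^k n zero    = ≤-refl
nP′k≤n^k n (suc k) = *-mono-≤ (m∸n≤m n k) (nP′k≤n^k n k)

-- The bound m is kept apart from k so that the base `n ∸ m` stays fixed in the induction on k.
[n∸m]^k≤nP′k : ∀ n {m} k → k ≤ m → (n ∸ m) ^ k ≤ n P′ k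
[n∸m]^k≤nP′k n zero    _   = ≤-refl
[n∸m]^k≤nP′k n (suc k) k<m =
  *-mono-≤ (∸-monoʳ-≤ n (<⇒≤ k<m)) ([n∸m]^k≤nP′k n k (<⇒≤ k<m))

-- The Kővári-Sós-Turán theorem.

module KőváriSósTurán {V : Set} (adj : V → V → Bool) where

  deg : List V → V → ℕ
  deg xs v = length (filterᵇ (adj v) xs)

  weight : ℕ → List V → List V → ℕ
  weight j xs ws = sum (map (λ v → deg xs v P′ j) ws)

  nbrs : V → List V → List V
  nbrs x = filterᵇ (λ v → adj v x)

  -- Pascal's rule summed over `ws`: adding x raises the degree of exactly its neighbours, by one.
  weight-∷ : ∀ j x xs ws →
    weight (suc j) (x ∷ xs) ws ≡ weight (suc j) xs ws + suc j * weight j xs (nbrs x ws)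
  weight-∷ j x xs [] = sym (*-zeroʳ j)
  weight-∷ j x xs (w ∷ ws) with adj w x | weight-∷ j x xs ws
  ... | false | ih = trans (cong (deg xs w P′ suc j +_) ih) (sym (+-assoc (deg xs w P′ suc j) _ _))
  ... | true  | ih = trans (cong₂ _+_ (P′-pascal (deg xs w) j) ih)
    (regroup (deg xs w P′ suc j) (suc j) (deg xs w P′ j) (weight (suc j) xs ws) _)
    where
    regroup : ∀ p c d a n → p + c * d + (a + c * n) ≡ p + a + c * (d + n)
    regroup = solve-∀

  weight-0 : ∀ xs ws → weight 0 xs ws ≡ length ws
  weight-0 xs []       = refl
  weight-0 xs (w ∷ ws) = cong suc (weight-0 xs ws)

  weight-[] : ∀ j ws → weight (suc j) [] ws ≡ 0
  weight-[] j []       = refl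
  weight-[] j (w ∷ ws) = cong₂ _+_ (nP′k≡0 {0} {suc j} z<s) (weight-[] j ws)

  -- Symmetry of `adj` is not assumed, so its arguments come in the order used by `deg`: from a
  -- vertex of `ws` into `xs`.
  Biclique : List V → List V → Set
  Biclique ys zs = All (λ y → All (λ z → T (adj z y)) zs) ys

  -- Σ_w (deg w)(deg w ∸ 1)⋯ counts the ordered stars with j leaves in xs, and
  -- Pascal's rule lets the pigeonhole decide one element of xs at a time.
  biclique : ∀ j xs ws s → s * (length xs P′ j) < weight j xs ws →
    ∃[ ys ] ∃[ zs ] ys ⊆ xs × zs ⊆ ws × length ys ≡ j × s < length zs × Biclique ys zs
  biclique zero xs ws s lt =
    [] , ws , minimum xs , ⊆-refl , refl ,
    subst (_< _) (*-identityʳ s) (<-≤-trans lt (≤-reflexive (weight-0 xs ws))) , []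
  biclique (suc j) [] ws s lt with () ← <-≤-trans lt (≤-reflexive (weight-[] j ws))
  biclique (suc j) (x ∷ xs) ws s lt
    with s * (length xs P′ suc j) <? weight (suc j) xs ws | s * (length xs P′ j) <? weight j xs (nbrs x ws)
  ... | yes lt′ | _ with biclique (suc j) xs ws s lt′
  ...   | ys , zs , ys⊆ , rest = ys , zs , x ∷ʳ ys⊆ , rest
  biclique (suc j) (x ∷ xs) ws s lt | no _ | yes lt′ with biclique j xs (nbrs x ws) s lt′
  ...   | ys , zs , ys⊆ , zs⊆ , len , s< , full =
    x ∷ ys , zs , refl ∷ ys⊆ , ⊆-trans zs⊆ (filter-⊆ (T? ∘ λ v → adj v x) ws) , cong suc len , s< ,
    All-resp-⊆ zs⊆ (all-filter (T? ∘ λ v → adj v x) ws) ∷ full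
  -- If both parts were at most their shares, Pascal's rule on each side would contradict `lt`.
  biclique (suc j) (x ∷ xs) ws s lt | no ≮₁ | no ≮₂ = ⊥-elim (<-irrefl refl (begin-strict
    s * (suc (length xs) P′ suc j)
      <⟨ lt ⟩
    weight (suc j) (x ∷ xs) ws
      ≡⟨ weight-∷ j x xs ws ⟩
    weight (suc j) xs ws + suc j * weight j xs (nbrs x ws)
      ≤⟨ +-mono-≤ (≮⇒≥ ≮₁) (*-monoʳ-≤ (suc j) (≮⇒≥ ≮₂)) ⟩
    s * (length xs P′ suc j) + suc j * (s * (length xs P′ j))
      ≡⟨ factor s (length xs P′ suc j) (suc j) (length xs P′ j) ⟩
    s * (length xs P′ suc j + suc j * (length xs P′ j))
      ≡⟨ cong (s *_) (P′-pascal (length xs) j) ⟨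
    s * (suc (length xs) P′ suc j) ∎))
    where
    factor : ∀ s p c q → s * p + c * (s * q) ≡ s * (p + c * q)
    factor = solve-∀

  degree-sum≤ : ∀ t xs ws → sum (map (deg xs) ws) ≤ sum (map (_∸ t) (map (deg xs) ws)) + length ws * t
  degree-sum≤ t xs [] = z≤n
  degree-sum≤ t xs (w ∷ ws) = begin
    deg xs w + sum (map (deg xs) ws)
      ≤⟨ +-mono-≤ (m≤n+m∸n (deg xs w) t) (degree-sum≤ t xs ws) ⟩
    t + (deg xs w ∸ t) + (sum (map (_∸ t) (map (deg xs) ws)) + length ws * t)
      ≡⟨ regroup t (deg xs w ∸ t) _ (length ws * t) ⟩
    (deg xs w ∸ t) + sum (map (_∸ t) (map (deg xs) ws)) + (t + length ws * t) ∎
    where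
    regroup : ∀ t d s l → t + d + (s + l) ≡ d + s + (t + l)
    regroup = solve-∀

  -- Truncating the degrees replaces falling factorials by pure powers, to which the power mean
  -- inequality applies.
  powerSum≤weight : ∀ t xs ws → powerSum t (map (_∸ t) (map (deg xs) ws)) ≤ weight t xs ws
  powerSum≤weight t xs []       = z≤n
  powerSum≤weight t xs (w ∷ ws) = +-mono-≤ ([n∸m]^k≤nP′k (deg xs w) t ≤-refl) (powerSum≤weight t xs ws)

  -- If the degree sum is at most 2tn, the bound is trivial; otherwise
  -- truncating every degree by t at most halves it, and the power mean applies.
  degree-sum-bound : ∀ j xs ws → let t = suc j; n = length ws in
    length xs ≡ n → 0 < n → weight t xs ws ≤ t * (length xs P′ t) →
    sum (map (deg xs) ws) ^ t ≤ (2 * t) ^ t * n ^ (2 * t ∸ 1)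
  degree-sum-bound j xs ws len 0<n bound = bounded (≤-total D (n * t))
    where
    t = suc j
    n = length ws
    S = sum (map (deg xs) ws)
    ds = map (_∸ t) (map (deg xs) ws)
    D = sum ds
    instance
      n≢0 : NonZero n
      n≢0 = >-nonZero 0<n
    S≤2* : ∀ {x} → D ≤ x → n * t ≤ x → S ≤ 2 * x
    S≤2* {x} p q = ≤-trans (degree-sum≤ t xs ws)
      (≤-trans (+-mono-≤ p q) (≤-reflexive (cong (x +_) (sym (+-identityʳ x)))))
    t≤2t∸1 : t ≤ 2 * t ∸ 1
    t≤2t∸1 = ≤-trans (≤-reflexive (sym (+-identityʳ t))) (m≤n+m (t + 0) j)
    length-ds : length ds ≡ n
    length-ds = trans (length-map (_∸ t) (map (deg xs) ws)) (length-map (deg xs) ws)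
    powerSum≤ : powerSum t ds ≤ t ^ t * n ^ t
    powerSum≤ = begin
      powerSum t ds           ≤⟨ powerSum≤weight t xs ws ⟩
      weight t xs ws          ≤⟨ bound ⟩
      t * (length xs P′ t)    ≡⟨ cong (λ l → t * (l P′ t)) len ⟩
      -- The factor t is weakened to `t ^ t`, so that the final constant is a t-th power.
      t * (n P′ t)            ≤⟨ *-mono-≤ (m≤m*n t (t ^ j) {{m^n≢0 t j}}) (nP′k≤n^k n t) ⟩
      t ^ t * n ^ t           ∎
    assoc : ∀ n t → 2 * (n * t) ≡ 2 * t * n
    assoc = solve-∀
    interchange : ∀ a b c d → a * (b * (c * d)) ≡ a * c * (b * d)
    interchange = solve-∀
    bounded : D ≤ n * t ⊎ n * t ≤ D → S ^ t ≤ (2 * t) ^ t * n ^ (2 * t ∸ 1)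
    bounded (inj₁ D≤nt) = begin
      S ^ t                          ≤⟨ ^-monoˡ-≤ t (S≤2* D≤nt ≤-refl) ⟩
      (2 * (n * t)) ^ t              ≡⟨ cong (_^ t) (assoc n t) ⟩
      (2 * t * n) ^ t                ≡⟨ ^-distribʳ-* t (2 * t) n ⟩
      (2 * t) ^ t * n ^ t            ≤⟨ *-monoʳ-≤ ((2 * t) ^ t) (^-monoʳ-≤ n t≤2t∸1) ⟩
      (2 * t) ^ t * n ^ (2 * t ∸ 1)  ∎
    bounded (inj₂ nt≤D) = begin
      S ^ t                                     ≤⟨ ^-monoˡ-≤ t (S≤2* ≤-refl nt≤D) ⟩
      (2 * D) ^ t                               ≡⟨ ^-distribʳ-* t 2 D ⟩
      2 ^ t * D ^ t                             ≤⟨ *-monoʳ-≤ (2 ^ t) (power-mean j ds) ⟩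
      2 ^ t * (length ds ^ j * powerSum t ds)
        ≤⟨ *-monoʳ-≤ (2 ^ t) (*-mono-≤ (≤-reflexive (cong (_^ j) length-ds)) powerSum≤) ⟩
      2 ^ t * (n ^ j * (t ^ t * n ^ t))         ≡⟨ interchange (2 ^ t) (n ^ j) (t ^ t) (n ^ t) ⟩
      2 ^ t * t ^ t * (n ^ j * n ^ t)
        -- By computation, `2 * t ∸ 1` is `j + (t + 0)`.
        ≡⟨ cong₂ _*_ (^-distribʳ-* t 2 t)
             (trans (cong (λ u → n ^ (j + u)) (+-identityʳ t)) (^-distribˡ-+-* n j t)) ⟨
      (2 * t) ^ t * n ^ (2 * t ∸ 1)             ∎

  -- A degree sum this large makes the stars with t leaves outnumber the ordered t-tuples of `xs` by
  -- more than a factor t, so some t vertices have more than t common neighbours.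
  kővári-sós-turán : ∀ t xs ws → let n = length ws in 0 < t →
    length xs ≡ n → 0 < n → (2 * t) ^ t * n ^ (2 * t ∸ 1) < sum (map (deg xs) ws) ^ t →
    ∃[ ys ] ∃[ zs ] ys ⊆ xs × zs ⊆ ws × length ys ≡ t × t < length zs × Biclique ys zs
  kővári-sós-turán (suc j) xs ws _ len 0<n large = biclique (suc j) xs ws (suc j)
    (≰⇒> λ bound → <⇒≱ large (degree-sum-bound j xs ws len 0<n bound))

-- Lists of pairwise related elements, and the pigeonhole principle.

AllPairs-resp-⊆ : ∀ {A : Set} {R : A → A → Set} {xs ys} → xs ⊆ ys → AllPairs R ys → AllPairs R xs
AllPairs-resp-⊆ []           []         = []
AllPairs-resp-⊆ (_ ∷ʳ xs⊆)   (_ ∷ rs)   = AllPairs-resp-⊆ xs⊆ rs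
AllPairs-resp-⊆ (refl ∷ xs⊆) (r ∷ rs)   = All-resp-⊆ xs⊆ r ∷ AllPairs-resp-⊆ xs⊆ rs

AllPairs-lookup : ∀ {A : Set} {R : A → A → Set} → Symmetric R → ∀ {xs} → AllPairs R xs →
  ∀ i j → i ≢ j → R (lookup xs i) (lookup xs j)
AllPairs-lookup R-sym (_ ∷ _)  zero    zero    i≢j = ⊥-elim (i≢j refl)
AllPairs-lookup R-sym (r ∷ _)  zero    (suc j) _   = All.lookup r (∈-lookup j)
AllPairs-lookup R-sym (r ∷ _)  (suc i) zero    _   = R-sym (All.lookup r (∈-lookup i))
AllPairs-lookup R-sym (_ ∷ rs) (suc i) (suc j) i≢j = AllPairs-lookup R-sym rs i j (i≢j ∘ cong suc)

choose : ∀ {a} {A : Set a} → Bool → A → A → A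
choose q a b = if q then a else b

-- The slack of one pays for a vertex set aside before the others are split by color.
m+m≤1+a+b⇒m≤a∨m≤b : ∀ {m a b} → m + m ≤ suc (a + b) → m ≤ a ⊎ m ≤ b
m+m≤1+a+b⇒m≤a∨m≤b {m} {a} {b} le with m ≤? a | m ≤? b
... | yes m≤a | _       = inj₁ m≤a
... | no _    | yes m≤b = inj₂ m≤b
... | no m≰a  | no m≰b  = ⊥-elim (<⇒≱ (s≤s (≤-reflexive (sym (+-suc a b))))
  (≤-trans (+-mono-≤ (≰⇒> m≰a) (≰⇒> m≰b)) le))

2^m+2^m≡2^[1+m] : ∀ m → 2 ^ m + 2 ^ m ≡ 2 ^ suc m
2^m+2^m≡2^[1+m] m = cong (2 ^ m +_) (sym (+-identityʳ (2 ^ m)))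

m<2^m : ∀ m → m < 2 ^ m
m<2^m zero    = z<s
m<2^m (suc m) = ≤-trans (+-mono-≤ (m^n>0 2 m) (m<2^m m)) (≤-reflexive (2^m+2^m≡2^[1+m] m))

module _ {V : Set} where

  separate : ∀ {P : Bool → V → Set} {xs} → All (λ x → ∃[ q ] P q x) xs →
    Σ[ f ∈ (Bool → List V) ] (∀ q → f q ⊆ xs × All (P q) (f q)) ×
    length xs ≡ length (f true) + length (f false)
  separate [] = (λ _ → []) , (λ _ → [] , []) , refl
  separate {xs = x ∷ xs} ((q , p) ∷ ps) with separate ps
  separate {xs = x ∷ xs} ((true , p) ∷ ps) | f , sound , len =
    (λ q → if q then x ∷ f true else f false) ,
    (λ { true → refl ∷ proj₁ (sound true) , p ∷ proj₂ (sound true)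
       ; false → x ∷ʳ proj₁ (sound false) , proj₂ (sound false) }) ,
    cong suc len
  separate {xs = x ∷ xs} ((false , p) ∷ ps) | f , sound , len =
    (λ q → if q then f true else x ∷ f false) ,
    (λ { true → x ∷ʳ proj₁ (sound true) , proj₂ (sound true)
       ; false → refl ∷ proj₁ (sound false) , p ∷ proj₂ (sound false) }) ,
    trans (cong suc len) (sym (+-suc _ _))

  majority : ∀ {P : Bool → V → Set} {xs} m → All (λ x → ∃[ q ] P q x) xs → m + m ≤ suc (length xs) →
    ∃[ q ] ∃[ ys ] ys ⊆ xs × m ≤ length ys × All (P q) ys
  majority m ps le with separate ps
  ... | f , sound , len with m+m≤1+a+b⇒m≤a∨m≤b (≤-trans le (s≤s (≤-reflexive len)))
  ...   | inj₁ m≤ = true  , f true  , proj₁ (sound true)  , m≤ , proj₂ (sound true)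
  ...   | inj₂ m≤ = false , f false , proj₁ (sound false) , m≤ , proj₂ (sound false)

-- Ramsey's theorem and its bipartite form.

module Ramsey {V : Set} (_≟_ : DecidableEquality V) (E : Bool → V → V → Set)
  (E-total : ∀ {x y} → x ≢ y → ∃[ q ] E q x y) where

  Clique : Bool → List V → Set
  Clique q = AllPairs (E q)

  halve : ∀ m {x xs} → All (x ≢_) xs → 2 ^ suc m ≤ suc (length xs) →
    ∃[ q ] ∃[ ys ] ys ⊆ xs × 2 ^ m ≤ length ys × All (E q x) ys
  halve m x∉xs le = majority (2 ^ m) (All.map E-total x∉xs) (≤-trans (≤-reflexive (2^m+2^m≡2^[1+m] m)) le)

  -- A vertex keeps only its neighbours in a majority color. This costs a factor of two and lowers
  -- by one the clique size still required in that color.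
  ramsey : ∀ a b {xs} → Unique xs → 2 ^ (a + b) ≤ length xs →
    ∃[ q ] ∃[ ys ] ys ⊆ xs × choose q a b ≤ length ys × Clique q ys
  ramsey zero    _       _ _  = true  , [] , minimum _ , z≤n , []
  ramsey (suc a) zero    _ _  = false , [] , minimum _ , z≤n , []
  ramsey (suc a) (suc b) {[]} _ le = ⊥-elim (<⇒≱ (m^n>0 2 (suc a + suc b)) le)
  ramsey (suc a) (suc b) {x ∷ xs} (x∉xs ∷ unique) le with halve (a + suc b) x∉xs le
  ... | true , ys , ys⊆ , le′ , red with ramsey a (suc b) (AllPairs-resp-⊆ ys⊆ unique) le′
  ...   | true  , zs , zs⊆ , a≤ , clique =
    true , x ∷ zs , refl ∷ ⊆-trans zs⊆ ys⊆ , s≤s a≤ , All-resp-⊆ zs⊆ red ∷ clique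
  ...   | false , zs , zs⊆ , b≤ , clique = false , zs , x ∷ʳ ⊆-trans zs⊆ ys⊆ , b≤ , clique
  ramsey (suc a) (suc b) {x ∷ xs} (x∉xs ∷ unique) le | false , ys , ys⊆ , le′ , blue
    with ramsey (suc a) b (AllPairs-resp-⊆ ys⊆ unique) (subst (λ c → 2 ^ c ≤ length ys) (+-suc a b) le′)
  ...   | true  , zs , zs⊆ , a≤ , clique = true , zs , x ∷ʳ ⊆-trans zs⊆ ys⊆ , a≤ , clique
  ...   | false , zs , zs⊆ , b≤ , clique =
    false , x ∷ zs , refl ∷ ⊆-trans zs⊆ ys⊆ , s≤s b≤ , All-resp-⊆ zs⊆ blue ∷ clique

  delete : ∀ x {xs} → Unique xs → ∃[ ys ] ys ⊆ xs × All (x ≢_) ys × length xs ≤ suc (length ys)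
  delete x [] = [] , [] , [] , z≤n
  delete x {y ∷ xs} (y∉xs ∷ unique) with x ≟ y
  ... | yes refl = xs , y ∷ʳ ⊆-refl , y∉xs , ≤-refl
  ... | no x≢y with delete x unique
  ...   | ys , ys⊆ , x∉ys , le = y ∷ ys , refl ∷ ys⊆ , x≢y ∷ x∉ys , s≤s le

  -- Each vertex of `xs` costs a factor of two. It may itself occur in `ys`, so it is deleted first,
  -- which the slack in `halve` permits.
  homogenize : ∀ m xs {ys} → Unique ys → 2 ^ (length xs + m) ≤ length ys →
    ∃[ zs ] zs ⊆ ys × 2 ^ m ≤ length zs × All (λ x → ∃[ q ] All (E q x) zs) xs
  homogenize m []       {ys} _ le = ys , ⊆-refl , le , []
  homogenize m (x ∷ xs) unique le with delete x unique
  ... | ws , ws⊆ , x∉ws , le′ with halve (length xs + m) x∉ws (≤-trans le le′)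
  ...   | q , vs , vs⊆ , le″ , mono with homogenize m xs (AllPairs-resp-⊆ (⊆-trans vs⊆ ws⊆) unique) le″
  ...     | zs , zs⊆ , le‴ , monos =
    zs , ⊆-trans zs⊆ (⊆-trans vs⊆ ws⊆) , le‴ , (q , All-resp-⊆ zs⊆ mono) ∷ monos

  -- Once every vertex of `xs` sees `zs` in a single color, a majority color among these vertices
  -- finishes.
  bipartite-ramsey : ∀ k {xs ys} → Unique ys → k + k ≤ length xs → 2 ^ (length xs + k) ≤ length ys →
    ∃[ q ] ∃[ ws ] ∃[ zs ] ws ⊆ xs × zs ⊆ ys × k ≤ length ws × k ≤ length zs ×
    All (λ x → All (E q x) zs) ws
  bipartite-ramsey k {xs} unique le le′ with homogenize k xs unique le′
  ... | zs , zs⊆ , 2^k≤ , monos with majority k monos (m≤n⇒m≤1+n le)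
  ...   | q , ws , ws⊆ , k≤ , mono = q , ws , zs , ws⊆ , zs⊆ , k≤ , ≤-trans (<⇒≤ (m<2^m k)) 2^k≤ , mono

-- Edge counts and degree sums.

length-filter-cartesianProduct : ∀ {A B : Set} {P : A × B → Set} (P? : Decidable P) xs ys →
  length (filter P? (cartesianProduct xs ys)) ≡
  sum (map (λ x → length (filterᵇ (λ y → does (P? (x , y))) ys)) xs)
length-filter-cartesianProduct P? []       ys = refl
length-filter-cartesianProduct P? (x ∷ xs) ys = begin-equality
  length (filter P? (map (x ,_) ys ++ cartesianProduct xs ys))
    ≡⟨ cong length (filter-++ P? (map (x ,_) ys) _) ⟩
  length (filter P? (map (x ,_) ys) ++ filter P? (cartesianProduct xs ys))
    ≡⟨ length-++ (filter P? (map (x ,_) ys)) ⟩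
  length (filter P? (map (x ,_) ys)) + length (filter P? (cartesianProduct xs ys))
    ≡⟨ cong₂ _+_ (row ys) (length-filter-cartesianProduct P? xs ys) ⟩
  length (filterᵇ (λ y → does (P? (x , y))) ys) +
  sum (map (λ x → length (filterᵇ (λ y → does (P? (x , y))) ys)) xs) ∎
  where
  row : ∀ ys → length (filter P? (map (x ,_) ys)) ≡ length (filterᵇ (λ y → does (P? (x , y))) ys)
  row [] = refl
  row (y ∷ ys) with does (P? (x , y))
  ... | true  = cong suc (row ys)
  ... | false = row ys

length-filter-∧ : ∀ {A : Set} (f g : A → Bool) xs →
  length (filterᵇ (λ x → f x ∧ g x) xs) ≤ length (filterᵇ g xs)
length-filter-∧ f g [] = z≤n
length-filter-∧ f g (x ∷ xs) with f x | g x
... | true  | true  = s≤s (length-filter-∧ f g xs)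
... | true  | false = length-filter-∧ f g xs
... | false | true  = m≤n⇒m≤1+n (length-filter-∧ f g xs)
... | false | false = length-filter-∧ f g xs

sum-map-≤ : ∀ {A : Set} {f g : A → ℕ} → (∀ x → f x ≤ g x) → ∀ xs → sum (map f xs) ≤ sum (map g xs)
sum-map-≤ f≤g []       = z≤n
sum-map-≤ f≤g (x ∷ xs) = +-mono-≤ (f≤g x) (sum-map-≤ f≤g xs)

-- Each edge is listed in the row of its smaller endpoint, and that row is part of a neighbourhood.
e≤degree-sum : ∀ {n} (G : Graph n) → e G ≤ sum (map (λ i → length (filterᵇ (adj G i) (allFin n))) (allFin n))
e≤degree-sum {n} G = ≤-trans
  (≤-reflexive (length-filter-cartesianProduct
    (λ (i , j) → (i Fin.<? j) ×-dec T? (adj G i j)) (allFin n) (allFin n)))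
  (sum-map-≤ (λ i → length-filter-∧ (λ j → does (i Fin.<? j)) (adj G i) (allFin n)) (allFin n))

-- Unavoidable patterns in dense colorings.

adj⇒≢ : ∀ {n} (G : Graph n) {i j} → T (adj G i j) → i ≢ j
adj⇒≢ G {i} Gii refl = subst T (adj-irrefl G i) Gii

-- A vertex class is a Bool. In a pattern of a shape, the core edges are those
-- inside class true (clique) or between the classes (cut).
data Shape : Set where
  clique cut : Shape

core : Shape → Bool → Bool → Bool
core clique = _∧_
core cut    = _xor_

paint : Shape → Bool → Bool → Bool → Bool
paint p q s t = choose (core p s t) q (not q)

paint-comm : ∀ p q s t → paint p q s t ≡ paint p q t s
paint-comm clique q s t = cong (λ x → choose x q (not q)) (∧-comm s t)
paint-comm cut    q s t = cong (λ x → choose x q (not q)) (xor-comm s t)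

color : ∀ {n} → Coloring n → Bool → Graph n
color c q = choose q (R c) (B c)

-- The size that `bipartite-ramsey` asks of one clique when the other has `k + k` vertices.
cliqueSize : ℕ → ℕ
cliqueSize k = 2 ^ (k + k + k)

-- By `ramsey`, a set of this size contains a monochromatic clique on `cliqueSize k` vertices. This
-- number is also the m of the theorem.
bicliqueSize : ℕ → ℕ
bicliqueSize k = 2 ^ (cliqueSize k + cliqueSize k)

module Patterns {n} (c : Coloring n) where

  E : Bool → Fin n → Fin n → Set
  E q i j = T (adj (color c q) i j)

  E-sym : ∀ q {i j} → E q i j → E q j i
  E-sym q {i} {j} = subst T (adj-sym (color c q) i j)

  E-total : ∀ {i j} → i ≢ j → ∃[ q ] E q i j
  E-total {i} {j} i≢j with adj (R c) i j in eq
  ... | true  = true , subst T (sym eq) _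
  ... | false = false , subst T (sym (trans (partition c i j i≢j) (cong not eq))) _

  E⇒≢ : ∀ q {i j} → E q i j → i ≢ j
  E⇒≢ q = adj⇒≢ (color c q)

  open Ramsey Fin._≟_ E E-total

  -- Distinctness of the vertices, within a side and across sides, follows from the adjacencies, as
  -- neither color has loops.
  record Pattern (p : Shape) (q : Bool) (k : ℕ) : Set where
    field
      side    : Bool → List (Fin n)
      large   : ∀ s → k ≤ length (side s)
      cliques : ∀ s → Clique (paint p q s s) (side s)
      cross   : All (λ x → All (E (paint p q true false) x) (side false)) (side true)

    -- Each side reserves a slot for every vertex of a graph on k vertices, so any assignment of its
    -- vertices to sides can be realized.
    place : Bool → Fin k → Fin n
    place s u = lookup (side s) (inject≤ u (large s))

    place-adj : ∀ s t {u v} → u ≢ v → E (paint p q s t) (place s u) (place t v)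
    place-adj true  true  u≢v = AllPairs-lookup (E-sym _) (cliques true) _ _ (u≢v ∘ inject≤-injective _ _ _ _)
    place-adj false false u≢v = AllPairs-lookup (E-sym _) (cliques false) _ _ (u≢v ∘ inject≤-injective _ _ _ _)
    place-adj true  false _   = All.lookup (All.lookup cross (∈-lookup _)) (∈-lookup _)
    place-adj false true  _   = subst (λ q → E q _ _) (paint-comm p q true false)
      (E-sym _ (All.lookup (All.lookup cross (∈-lookup _)) (∈-lookup _)))

  mkPattern : ∀ {k} p q {xs ys} → k ≤ length xs → k ≤ length ys →
    Clique (paint p q true true) xs → Clique (paint p q false false) ys →
    All (λ x → All (E (paint p q true false) x) ys) xs → Pattern p q k
  mkPattern p q {xs} {ys} xs-large ys-large xs-clique ys-clique cross = record
    { side    = λ s → choose s xs ys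
    ; large   = λ { true → xs-large ; false → ys-large }
    ; cliques = λ { true → xs-clique ; false → ys-clique }
    ; cross   = cross
    }

  Unavoidable : ℕ → Set
  Unavoidable k = ∃[ p ] ∃[ q ] Pattern p q k

  E-swap : ∀ q {xs ys} → All (λ x → All (λ y → E q y x) ys) xs → All (λ x → All (E q x) ys) xs
  E-swap q = All.map (All.map (E-sym q))

  -- The edges found between the cliques share the color of one of them, so the other becomes the
  -- core of a `clique` pattern.
  opposite-cliques : ∀ k {xs ys} → Clique true xs → Clique false ys →
    k + k ≡ length xs → 2 ^ (k + k + k) ≤ length ys → Unavoidable k
  opposite-cliques k red blue len le
    with bipartite-ramsey k (AllPairs.map (E⇒≢ false) blue) (≤-reflexive len) (subst (λ l → 2 ^ (l + k) ≤ _) len le)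
  ... | true , ws , zs , ws⊆ , zs⊆ , k≤ , k≤′ , mono =
    clique , false , mkPattern clique false k≤′ k≤ (AllPairs-resp-⊆ zs⊆ blue) (AllPairs-resp-⊆ ws⊆ red)
      (E-swap true (All-swap mono))
  ... | false , ws , zs , ws⊆ , zs⊆ , k≤ , k≤′ , mono =
    clique , true , mkPattern clique true k≤ k≤′ (AllPairs-resp-⊆ ws⊆ red) (AllPairs-resp-⊆ zs⊆ blue) mono

  -- Suppose the clique found in `xs` lacks color q. Then the clique found in `ys` completes a
  -- `clique` pattern if it has color q, and a `cut` pattern otherwise.
  biclique⇒clique : ∀ l q {xs ys} → Unique xs → Unique ys → 2 ^ (l + l) ≤ length xs → 2 ^ (l + l) ≤ length ys →
    All (λ x → All (E q x) ys) xs → (∃[ zs ] l ≤ length zs × Clique q zs) ⊎ Unavoidable l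
  biclique⇒clique l q unique unique′ le le′ full with ramsey l l unique le | ramsey l l unique′ le′
  ... | q₁ , ws , ws⊆ , l≤ , clq₁ | q₂ , zs , zs⊆ , l≤′ , clq₂ =
    conclude q q₁ q₂ (≤-trans (≤-reflexive (sym (choose-same q₁))) l≤) (≤-trans (≤-reflexive (sym (choose-same q₂))) l≤′) clq₁ clq₂
      (All.map (All-resp-⊆ zs⊆) (All-resp-⊆ ws⊆ full))
    where
    choose-same : ∀ q → choose q l l ≡ l
    choose-same true  = refl
    choose-same false = refl
    conclude : ∀ q q₁ q₂ {ws zs} → l ≤ length ws → l ≤ length zs → Clique q₁ ws → Clique q₂ zs →
      All (λ x → All (E q x) zs) ws → (∃[ zs ] l ≤ length zs × Clique q zs) ⊎ Unavoidable l
    conclude true  true  _     l≤ _   clq₁ _    _    = inj₁ (_ , l≤ , clq₁)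
    conclude false false _     l≤ _   clq₁ _    _    = inj₁ (_ , l≤ , clq₁)
    conclude true  false true  l≤ l≤′ clq₁ clq₂ full = inj₂ (clique , false , mkPattern clique false l≤ l≤′ clq₁ clq₂ full)
    conclude false true  false l≤ l≤′ clq₁ clq₂ full = inj₂ (clique , true , mkPattern clique true l≤ l≤′ clq₁ clq₂ full)
    conclude true  false false l≤ l≤′ clq₁ clq₂ full = inj₂ (cut , true , mkPattern cut true l≤ l≤′ clq₁ clq₂ full)
    conclude false true  true  l≤ l≤′ clq₁ clq₂ full = inj₂ (cut , false , mkPattern cut false l≤ l≤′ clq₁ clq₂ full)

  shrink : ∀ {k l p q} → k ≤ l → Pattern p q l → Pattern p q k
  shrink k≤l P = record { Pattern P ; large = λ s → ≤-trans k≤l (Pattern.large P s) }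

  large-clique : ∀ k q → let t = bicliqueSize k in 0 < n → (2 * t) ^ t * n ^ (2 * t ∸ 1) < e (color c q) ^ t →
    (∃[ xs ] cliqueSize k ≤ length xs × Clique q xs) ⊎ Unavoidable (cliqueSize k)
  large-clique k q 0<n dense
    with kővári-sós-turán t (allFin n) (allFin n) (m^n>0 2 (cliqueSize k + cliqueSize k)) refl 0<length dense′
    where
    open KőváriSósTurán (adj (color c q))
    t = bicliqueSize k
    length-allFin : length (allFin n) ≡ n
    length-allFin = length-tabulate id
    0<length : 0 < length (allFin n)
    0<length = ≤-trans 0<n (≤-reflexive (sym length-allFin))
    dense′ : (2 * t) ^ t * length (allFin n) ^ (2 * t ∸ 1) < sum (map (deg (allFin n)) (allFin n)) ^ t
    dense′ = subst (λ m → (2 * t) ^ t * m ^ (2 * t ∸ 1) < sum (map (deg (allFin n)) (allFin n)) ^ t)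
      (sym length-allFin) (<-≤-trans dense (^-monoˡ-≤ t (e≤degree-sum (color c q))))
  ... | ys , zs , ys⊆ , zs⊆ , len , t< , full =
    biclique⇒clique (cliqueSize k) q (AllPairs-resp-⊆ ys⊆ (Unique.allFin⁺ n)) (AllPairs-resp-⊆ zs⊆ (Unique.allFin⁺ n))
      (≤-reflexive (sym len)) (<⇒≤ t<) (E-swap q full)

  k+k≤cliqueSize : ∀ k → k + k ≤ cliqueSize k
  k+k≤cliqueSize k = ≤-trans (<⇒≤ (m<2^m (k + k))) (^-monoʳ-≤ 2 (m≤m+n (k + k) k))

  unavoidable : ∀ k → let t = bicliqueSize k in 0 < n →
    (∀ q → (2 * t) ^ t * n ^ (2 * t ∸ 1) < e (color c q) ^ t) → Unavoidable k
  unavoidable k 0<n dense with large-clique k true 0<n (dense true) | large-clique k false 0<n (dense false)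
  ... | inj₂ (p , q , P) | _ = p , q , shrink (≤-trans (m≤m+n k k) (k+k≤cliqueSize k)) P
  ... | inj₁ _ | inj₂ (p , q , P) = p , q , shrink (≤-trans (m≤m+n k k) (k+k≤cliqueSize k)) P
  -- The red clique is cut to exactly `k + k` vertices, because the size required of the blue one
  -- grows with its length.
  ... | inj₁ (xs , le , red) | inj₁ (ys , le′ , blue) =
    opposite-cliques k (AllPairs-resp-⊆ (take-⊆ (k + k) xs) red) blue
      (sym (trans (length-take (k + k) xs) (m≤n⇒m⊓n≡m (≤-trans (k+k≤cliqueSize k) le)))) le′

-- Comparing edge counts along maps of vertices.

length-≤ : ∀ {A B : Set} (_~_ : A → B → Set) → (∀ {x x′ y} → x ~ y → x′ ~ y → x ≡ x′) →
  ∀ {xs ys} → Unique xs → (∀ {x} → x ∈ₗ xs → ∃[ y ] y ∈ₗ ys × x ~ y) → length xs ≤ length ys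
length-≤ _~_ ~-inj {xs} {ys} unique related = injective⇒≤ position-injective
  where
  partner : ∀ i → ∃[ y ] y ∈ₗ ys × lookup xs i ~ y
  partner i = related (∈-lookup i)
  position : Fin (length xs) → Fin (length ys)
  position i = index (proj₁ (proj₂ (partner i)))
  lookup-position : ∀ i → proj₁ (partner i) ≡ lookup ys (position i)
  lookup-position i = lookup-index (proj₁ (proj₂ (partner i)))
  position-injective : Injective _≡_ _≡_ position
  position-injective {i} {j} eq with i Fin.≟ j
  ... | yes i≡j = i≡j
  ... | no  i≢j = ⊥-elim (AllPairs-lookup ≢-sym unique i j i≢j
    (~-inj (proj₂ (proj₂ (partner i))) (subst (lookup xs j ~_) same (proj₂ (proj₂ (partner j))))))
    where
    same : proj₁ (partner j) ≡ proj₁ (partner i)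
    same = trans (lookup-position j) (trans (cong (lookup ys) (sym eq)) (sym (lookup-position i)))

edge⇒< : ∀ {n} (G : Graph n) {i j} → (i , j) ∈ₗ edges G → i Fin.< j × T (adj G i j)
edge⇒< {n} G ij∈ = proj₂
  (∈-filter⁻ (λ (i , j) → (i Fin.<? j) ×-dec T? (adj G i j)) {xs = cartesianProduct (allFin n) (allFin n)} ij∈)

<⇒edge : ∀ {n} (G : Graph n) {i j} → i Fin.< j → T (adj G i j) → (i , j) ∈ₗ edges G
<⇒edge G i<j Gij = ∈-filter⁺ (λ (i , j) → (i Fin.<? j) ×-dec T? (adj G i j))
  (∈-cartesianProduct⁺ (∈-allFin _) (∈-allFin _)) (i<j , Gij)

edges-unique : ∀ {n} (G : Graph n) → Unique (edges G)
edges-unique {n} G = Unique.filter⁺ _ (Unique.cartesianProduct⁺ (Unique.allFin⁺ n) (Unique.allFin⁺ n))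

-- A relation instead of a function lets an embedding be used in both directions.
e-mono : ∀ {a b} (G : Graph a) (H : Graph b) (_~_ : Fin a → Fin b → Set) →
  (∀ {i i′ u} → i ~ u → i′ ~ u → i ≡ i′) →
  (∀ {i j} → T (adj G i j) → ∃[ u ] ∃[ v ] i ~ u × j ~ v × T (adj H u v)) → e G ≤ e H
e-mono {a} {b} G H _~_ ~-inj edge-map = length-≤ _≈_ ≈-inj (edges-unique G) related
  where
  _≈_ : Fin a × Fin a → Fin b × Fin b → Set
  -- The relation may reverse the order of endpoints, so both orientations are allowed. The
  -- condition on i and j keeps `≈` injective.
  (i , j) ≈ (u , v) = i Fin.< j × ((i ~ u × j ~ v) ⊎ (i ~ v × j ~ u))
  ≈-inj : ∀ {x x′ y} → x ≈ y → x′ ≈ y → x ≡ x′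
  ≈-inj (_ , inj₁ (p , q)) (_ , inj₁ (p′ , q′)) = cong₂ _,_ (~-inj p p′) (~-inj q q′)
  ≈-inj (_ , inj₂ (p , q)) (_ , inj₂ (p′ , q′)) = cong₂ _,_ (~-inj p p′) (~-inj q q′)
  ≈-inj (i<j , inj₁ (p , q)) (i′<j′ , inj₂ (p′ , q′)) with refl ← ~-inj p q′ | refl ← ~-inj q p′ =
    ⊥-elim (<-asym i<j i′<j′)
  ≈-inj (i<j , inj₂ (p , q)) (i′<j′ , inj₁ (p′ , q′)) with refl ← ~-inj p q′ | refl ← ~-inj q p′ =
    ⊥-elim (<-asym i<j i′<j′)
  related : ∀ {x} → x ∈ₗ edges G → ∃[ y ] y ∈ₗ edges H × x ≈ y
  related {i , j} ij∈ with edge⇒< G ij∈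
  ... | i<j , Gij with edge-map Gij
  ...   | u , v , i~u , j~v , Huv with <-cmp u v
  ...     | tri< u<v _ _  = (u , v) , <⇒edge H u<v Huv , i<j , inj₁ (i~u , j~v)
  ...     | tri≈ _ refl _ = ⊥-elim (adj⇒≢ H Huv refl)
  ...     | tri> _ _ v<u  = (v , u) , <⇒edge H v<u (subst T (adj-sym H u v) Huv) , i<j , inj₂ (i~u , j~v)

e-cong : ∀ {n} (G H : Graph n) → (∀ i j → adj G i j ≡ adj H i j) → e G ≡ e H
e-cong G H G≗H = ≤-antisym
  (e-mono G H _≡_ (λ { refl refl → refl }) λ Gij → _ , _ , refl , refl , subst T (G≗H _ _) Gij)
  (e-mono H G _≡_ (λ { refl refl → refl }) λ Hij → _ , _ , refl , refl , subst T (sym (G≗H _ _)) Hij)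

e-embed : ∀ {k n} (G : Graph k) (H : Graph n) (φ : Fin k → Fin n) → Injective _≡_ _≡_ φ →
  (∀ u v → adj G u v ≡ adj H (φ u) (φ v)) → (∀ {i j} → T (adj H i j) → ∃[ u ] φ u ≡ i) → e G ≡ e H
e-embed G H φ φ-inj same covers = ≤-antisym
  (e-mono G H (λ u i → φ u ≡ i) (λ p q → φ-inj (trans p (sym q)))
    λ Guv → _ , _ , refl , refl , subst T (same _ _) Guv)
  (e-mono H G (λ i u → φ u ≡ i) (λ p q → trans (sym p) q) edge-back)
  where
  edge-back : ∀ {i j} → T (adj H i j) → ∃[ u ] ∃[ v ] φ u ≡ i × φ v ≡ j × T (adj G u v)
  edge-back {i} {j} Hij with covers Hij | covers (subst T (adj-sym H i j) Hij)
  ... | u , refl | v , refl = u , v , refl , refl , subst T (sym (same u v)) Hij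

-- Colored copies as injections.

pullback : ∀ {k n} → (Fin k → Fin n) → Graph n → Graph k
pullback φ H = record
  { adj        = λ u v → adj H (φ u) (φ v)
  ; adj-sym    = λ u v → adj-sym H (φ u) (φ v)
  ; adj-irrefl = λ u → adj-irrefl H (φ u)
  }

T-∧ˡ : ∀ {x y} → T (x ∧ y) → T x
T-∧ˡ = proj₁ ∘ Equivalence.to T-∧

-- Pulling the colors back to the vertices of `G` makes copies in different host colorings
-- comparable.
EmbeddedCopy : ∀ {k n} → Graph k → Coloring n → (r b : ℕ) → Set
EmbeddedCopy {k} {n} G c r b = Σ[ φ ∈ (Fin k → Fin n) ] Injective _≡_ _≡_ φ ×
  e (G ∩ pullback φ (R c)) ≡ r × e (G ∩ pullback φ (B c)) ≡ b

subset-≡ : ∀ {n} {S : Subset n} {x y : ∃[ i ] i ∈ S} → proj₁ x ≡ proj₁ y → x ≡ y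
subset-≡ {x = i , p} {y = _ , q} refl = cong (i ,_) ([]=-irrelevant p q)

copy⇒embedded : ∀ {k n} (G : Graph k) (c : Coloring n) {r b} → ColoredCopy G c r b → EmbeddedCopy G c r b
copy⇒embedded G c (H , iso , red , blue) =
  ι , ι-inj , trans (count (R c)) red , trans (count (B c)) blue
  where
  open _≅_ iso
  ι-inj : Injective _≡_ _≡_ ι
  ι-inj eq = Bijection.injective bijection (subset-≡ eq)
  count : ∀ K → e (G ∩ pullback ι K) ≡ e (graph H ∩ K)
  count K = e-embed (G ∩ pullback ι K) (graph H ∩ K) ι ι-inj
    (λ u v → cong (_∧ adj K (ι u) (ι v)) (preserves u v))
    λ {i} {j} HKij → let u , u↦i = Bijection.strictlySurjective bijection (i , supported H i j (T-∧ˡ HKij)) in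
      u , cong proj₁ u↦i

-- The subgraph is the image of `G`. Its vertex set and adjacency have Boolean values, obtained by
-- searching the finitely many preimages.
embedded⇒copy : ∀ {k n} (G : Graph k) (c : Coloring n) {r b} → EmbeddedCopy G c r b → ColoredCopy G c r b
embedded⇒copy {k} {n} G c (φ , φ-inj , red , blue) =
  image , record { bijection = bijection ; preserves = preserves } ,
  trans (sym (count (R c))) red , trans (sym (count (B c))) blue
  where
  hit? : ∀ i → Dec (∃[ u ] φ u ≡ i)
  hit? i = any? (λ u → φ u Fin.≟ i)
  edge? : ∀ i j → Dec (∃[ u ] ∃[ v ] φ u ≡ i × φ v ≡ j × T (adj G u v))
  edge? i j = any? λ u → any? λ v → (φ u Fin.≟ i) ×-dec (φ v Fin.≟ j) ×-dec T? (adj G u v)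
  edge-swap : ∀ i j → T ⌊ edge? i j ⌋ → T ⌊ edge? j i ⌋
  edge-swap i j ij with u , v , p , q , Guv ← toWitness {a? = edge? i j} ij =
    fromWitness (v , u , q , p , subst T (adj-sym G u v) Guv)
  T-ext : ∀ {x y} → (T x → T y) → (T y → T x) → x ≡ y
  T-ext {true}  {true}  _ _ = refl
  T-ext {true}  {false} f _ = ⊥-elim (f _)
  T-ext {false} {true}  _ g = ⊥-elim (g _)
  T-ext {false} {false} _ _ = refl
  edge⇒ : ∀ u v → T ⌊ edge? (φ u) (φ v) ⌋ → T (adj G u v)
  edge⇒ u v uv with u′ , v′ , p , q , Guv ← toWitness {a? = edge? (φ u) (φ v)} uv
    with refl ← φ-inj p | refl ← φ-inj q = Guv
  hits = Vec.tabulate (λ i → ⌊ hit? i ⌋)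
  ∈-hits⁺ : ∀ {i} → (∃[ u ] φ u ≡ i) → i ∈ hits
  ∈-hits⁺ {i} hit = Vec.lookup⇒[]= i hits (trans (Vec.lookup∘tabulate _ i) (Equivalence.to T-≡ (fromWitness hit)))
  ∈-hits⁻ : ∀ {i} → i ∈ hits → ∃[ u ] φ u ≡ i
  ∈-hits⁻ {i} i∈ = toWitness {a? = hit? i} (Equivalence.from T-≡ (trans (sym (Vec.lookup∘tabulate _ i)) (Vec.[]=⇒lookup i∈)))
  image : Subgraph n
  image = record
    { vertices = hits
    ; graph    = record
      { adj        = λ i j → ⌊ edge? i j ⌋
      ; adj-sym    = λ i j → T-ext (edge-swap i j) (edge-swap j i)
      ; adj-irrefl = λ i → T-ext (λ ii → let u , v , p , q , Guv = toWitness {a? = edge? i i} ii in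
          adj⇒≢ G Guv (φ-inj (trans p (sym q)))) λ ()
      }
    ; supported = λ i j ij → let u , _ , p , _ = toWitness {a? = edge? i j} ij in ∈-hits⁺ (u , p)
    }
  bijection : Fin k ⤖ (∃[ i ] i ∈ hits)
  bijection = mk⤖ {to = λ u → φ u , ∈-hits⁺ (u , refl)} ((λ eq → φ-inj (cong proj₁ eq)) ,
    strictlySurjective⇒surjective λ (i , i∈) → let u , p = ∈-hits⁻ i∈ in u , subset-≡ p)
  preserves : ∀ u v → adj G u v ≡ adj (graph image) (φ u) (φ v)
  preserves u v = T-ext (λ Guv → fromWitness (u , v , refl , refl , Guv)) (edge⇒ u v)
  count : ∀ K → e (G ∩ pullback φ K) ≡ e (graph image ∩ K)
  count K = e-embed (G ∩ pullback φ K) (graph image ∩ K) φ φ-inj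
    (λ u v → cong (_∧ adj K (φ u) (φ v)) (preserves u v))
    λ {i} {j} HKij → let u , _ , p , _ = toWitness {a? = edge? i j} (T-∧ˡ HKij) in u , p

-- Counting edges by peeling off vertices.

count : ∀ {n} → (Fin n → Bool) → ℕ
count {n} f = length (filterᵇ f (allFin n))

indicator : Bool → ℕ
indicator b = choose b 1 0

length-filter-tabulate : ∀ {A : Set} (f : A → Bool) {n} (g : Fin n → A) →
  length (filterᵇ f (tabulate g)) ≡ count (f ∘ g)
length-filter-tabulate f {zero}  g = refl
length-filter-tabulate f {suc n} g with f (g zero)
... | true  = cong suc (trans (length-filter-tabulate f (g ∘ suc)) (sym (length-filter-tabulate (f ∘ g) suc)))
... | false = trans (length-filter-tabulate f (g ∘ suc)) (sym (length-filter-tabulate (f ∘ g) suc))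

count-suc : ∀ {n} (f : Fin (suc n) → Bool) → count f ≡ indicator (f zero) + count (f ∘ suc)
count-suc f with f zero
... | true  = cong suc (length-filter-tabulate f suc)
... | false = length-filter-tabulate f suc

pairs : ∀ {n} → (Fin n → Fin n → Bool) → ℕ
pairs {zero}  f = 0
pairs {suc n} f = count (f zero ∘ suc) + pairs (λ i j → f (suc i) (suc j))

e≡pairs : ∀ {n} (G : Graph n) → e G ≡ pairs (adj G)
e≡pairs {n} G = trans
  (length-filter-cartesianProduct (λ (i , j) → (i Fin.<? j) ×-dec T? (adj G i j)) (allFin n) (allFin n))
  (rows (adj G))
  where
  rows : ∀ {n} (f : Fin n → Fin n → Bool) →
    sum (map (λ i → count (λ j → does (i Fin.<? j) ∧ f i j)) (allFin n)) ≡ pairs f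
  rows {zero}  f = refl
  -- Column `zero` never holds the larger endpoint, so it contributes 0 to every row.
  rows {suc n} f = cong₂ _+_ (count-suc (λ j → does (zero {n} Fin.<? j) ∧ f zero j)) (trans
    (cong sum (trans (map-tabulate suc _) (trans
      (tabulate-cong λ i → count-suc (λ j → does (suc i Fin.<? j) ∧ f (suc i) j))
      (sym (map-tabulate id _)))))
    (rows (λ i j → f (suc i) (suc j))))

count-not : ∀ {n} (f g : Fin n → Bool) → (∀ i → g i ≡ not (f i)) → count f + count g ≡ n
count-not {zero}  f g g≡ = refl
count-not {suc n} f g g≡ rewrite count-suc f | count-suc g | g≡ zero with f zero | count-not (f ∘ suc) (g ∘ suc) (g≡ ∘ suc)
... | true  | ih = cong suc ih
... | false | ih = trans (+-suc _ _) (cong suc ih)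

[1+n]C2 : ∀ n → suc n C 2 ≡ n + n C 2
[1+n]C2 n = trans (sym (nCk+nC[k+1]≡[n+1]C[k+1] n 1)) (cong (_+ n C 2) (nC1≡n n))

pairs-complement : ∀ {n} (f g : Fin n → Fin n → Bool) → (∀ i j → i ≢ j → g i j ≡ not (f i j)) →
  pairs f + pairs g ≡ n C 2
pairs-complement {zero}  f g g≡ = refl
pairs-complement {suc n} f g g≡ = begin-equality
  count (f zero ∘ suc) + pairs f′ + (count (g zero ∘ suc) + pairs g′)
    ≡⟨ interchange (count (f zero ∘ suc)) (pairs f′) (count (g zero ∘ suc)) (pairs g′) ⟩
  count (f zero ∘ suc) + count (g zero ∘ suc) + (pairs f′ + pairs g′)
    ≡⟨ cong₂ _+_ (count-not _ _ λ j → g≡ zero (suc j) λ ())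
         (pairs-complement f′ g′ λ i j i≢j → g≡ (suc i) (suc j) (i≢j ∘ suc-injective)) ⟩
  n + n C 2
    ≡⟨ [1+n]C2 n ⟨
  suc n C 2 ∎
  where
  f′ g′ : Fin n → Fin n → Bool
  f′ i j = f (suc i) (suc j)
  g′ i j = g (suc i) (suc j)
  interchange : ∀ a b c d → a + b + (c + d) ≡ a + c + (b + d)
  interchange = solve-∀

e[R]+e[B]≡nC2 : ∀ {n} (c : Coloring n) → e (R c) + e (B c) ≡ n C 2
e[R]+e[B]≡nC2 c = trans (cong₂ _+_ (e≡pairs (R c)) (e≡pairs (B c))) (pairs-complement _ _ (partition c))

-- Pattern colorings of complete graphs.

coloring : ∀ {n} → Shape → Bool → (Fin n → Bool) → Coloring n
coloring p q σ = record
  { R = part id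
  ; B = part not
  ; partition = λ i j i≢j → both i j (dec-false (i Fin.≟ j) i≢j)
  }
  where
  part : (Bool → Bool) → Graph _
  part f = record
    { adj        = λ i j → not (does (i Fin.≟ j)) ∧ f (paint p q (σ i) (σ j))
    ; adj-sym    = λ i j → cong₂ (λ d b → not d ∧ f b) (≟-comm i j) (paint-comm p q (σ i) (σ j))
    ; adj-irrefl = λ i → cong (λ d → not d ∧ f (paint p q (σ i) (σ i))) (dec-true (i Fin.≟ i) refl)
    }
    where
    ≟-comm : ∀ i j → does (i Fin.≟ j) ≡ does (j Fin.≟ i)
    ≟-comm i j with i Fin.≟ j
    ... | yes refl = sym (dec-true (i Fin.≟ i) refl)
    ... | no i≢j = sym (dec-false (j Fin.≟ i) (≢-sym i≢j))
  both : ∀ i j → does (i Fin.≟ j) ≡ false →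
    adj (part not) i j ≡ not (adj (part id) i j)
  both i j eq rewrite eq = refl

threshold : ∀ {n} → ℕ → Fin n → Bool
threshold a i = toℕ i <ᵇ a

coreEdges : Shape → ℕ → ℕ → ℕ
coreEdges clique a b = a C 2
coreEdges cut    a b = a * b

corePairs : ∀ {n} → Shape → ℕ → Fin n → Fin n → Bool
corePairs p a i j = not (does (i Fin.≟ j)) ∧ core p (threshold a i) (threshold a j)

count-const : ∀ n → count {n} (λ _ → true) ≡ n × count {n} (λ _ → false) ≡ 0
count-const zero    = refl , refl
count-const (suc n) = let t , f = count-const n in
  trans (count-suc {n} (λ _ → true)) (cong suc t) , trans (count-suc {n} (λ _ → false)) f

count-threshold : ∀ a b → count {a + b} (threshold a) ≡ a × count {a + b} (not ∘ threshold a) ≡ b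
count-threshold zero    b = let t , f = count-const b in f , t
count-threshold (suc a) b = let t , f = count-threshold a b in
  trans (count-suc {a + b} (threshold (suc a))) (cong suc t) ,
  trans (count-suc {a + b} (not ∘ threshold (suc a))) f

pairs-corePairs-0 : ∀ p n → pairs {n} (corePairs p 0) ≡ 0
pairs-corePairs-0 clique zero    = refl
pairs-corePairs-0 clique (suc n) = cong₂ _+_ (proj₂ (count-const n)) (pairs-corePairs-0 clique n)
pairs-corePairs-0 cut    zero    = refl
pairs-corePairs-0 cut    (suc n) = cong₂ _+_ (proj₂ (count-const n)) (pairs-corePairs-0 cut n)

-- Vertex `zero` has core edges to the a other vertices of its class for `clique`, and to the b
-- vertices of the other class for `cut`.
pairs-corePairs : ∀ p a b → pairs {a + b} (corePairs p a) ≡ coreEdges p a b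
pairs-corePairs p (suc a) b with ih ← pairs-corePairs p a b | t , f ← count-threshold a b with p
... | clique = trans (cong₂ _+_ t ih) (sym ([1+n]C2 a))
... | cut    = cong₂ _+_ f ih
pairs-corePairs clique zero b = pairs-corePairs-0 clique b
pairs-corePairs cut    zero b = pairs-corePairs-0 cut b

pairs-cong : ∀ {n} {f g : Fin n → Fin n → Bool} → (∀ i j → f i j ≡ g i j) → pairs f ≡ pairs g
pairs-cong {zero}  f≗g = refl
pairs-cong {suc n} {f} {g} f≗g = cong₂ _+_
  (cong length (filter-≐ (T? ∘ f zero ∘ suc) (T? ∘ g zero ∘ suc)
    ((λ {j} → subst T (f≗g zero (suc j))) , (λ {j} → subst T (sym (f≗g zero (suc j))))) (allFin n)))
  (pairs-cong λ i j → f≗g (suc i) (suc j))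

e-color : ∀ p q a b → e (color (coloring {a + b} p q (threshold a)) q) ≡ coreEdges p a b
e-color p true a b = trans (e≡pairs (R (coloring {a + b} p true (threshold a))))
  (trans (pairs-cong {a + b} λ i j → cong (not (does (i Fin.≟ j)) ∧_) (paint-true (core p (threshold a i) (threshold a j))))
    (pairs-corePairs p a b))
  where
  paint-true : ∀ x → choose x true false ≡ x
  paint-true true  = refl
  paint-true false = refl
e-color p false a b = trans (e≡pairs (B (coloring {a + b} p false (threshold a))))
  (trans (pairs-cong {a + b} λ i j → cong (not (does (i Fin.≟ j)) ∧_) (paint-false (core p (threshold a i) (threshold a j))))
    (pairs-corePairs p a b))
  where
  paint-false : ∀ x → not (choose x false true) ≡ x
  paint-false true  = refl
  paint-false false = refl

-- Patterns with half of the edges in each color.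

2*nC2+n≡n*n : ∀ n → 2 * (n C 2) + n ≡ n * n
2*nC2+n≡n*n zero    = refl
2*nC2+n≡n*n (suc n) = begin-equality
  2 * (suc n C 2) + suc n         ≡⟨ cong (λ m → 2 * m + suc n) ([1+n]C2 n) ⟩
  2 * (n + n C 2) + suc n         ≡⟨ expand n (n C 2) ⟩
  (2 * (n C 2) + n) + 2 * n + 1   ≡⟨ cong (λ m → m + 2 * n + 1) (2*nC2+n≡n*n n) ⟩
  n * n + 2 * n + 1               ≡⟨ square n ⟩
  suc n * suc n                   ∎
  where
  expand : ∀ n c → 2 * (n + c) + (1 + n) ≡ (2 * c + n) + 2 * n + 1
  expand = solve-∀
  square : ∀ n → n * n + 2 * n + 1 ≡ (1 + n) * (1 + n)
  square = solve-∀

HalfCore : Shape → ℕ → ℕ → Set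
HalfCore p a b = (a + b) C 2 ≡ 2 * coreEdges p a b

-- C(n,2) = 2 C(a,2) is the negative Pell equation (2n-1)² - 2(2a-1)² = -1. Here
-- n = 1 + v + w and a = 1 + v, and the step is multiplication by 3 + 2√2.
pell : ∀ N → ∃[ v ] ∃[ w ] N ≤ v + w × (v + w) * (v + w) + (v + w) ≡ 2 * (v * v + v)
pell zero = 0 , 0 , z≤n , refl
pell (suc N) with pell N
... | v , w , N≤ , eq = 5 * v + 2 * w + 2 , 2 * v + w + 1 ,
  ≤-trans (s≤s N≤) (≤-trans (m≤m+n (suc (v + w)) (6 * v + 2 * w + 2)) (≤-reflexive (grows v w))) ,
  -- With u = v + w, the step leaves u² + u - 2(v² + v) unchanged; adding terms on both sides avoids
  -- the subtraction.
  +-cancelʳ-≡ (2 * (v * v + v)) _ _ (begin-equality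
    u′ * u′ + u′ + 2 * (v * v + v)                     ≡⟨ step v w ⟩
    2 * (v′ * v′ + v′) + ((v + w) * (v + w) + (v + w)) ≡⟨ cong (2 * (v′ * v′ + v′) +_) eq ⟩
    2 * (v′ * v′ + v′) + 2 * (v * v + v)               ∎)
  where
  v′ = 5 * v + 2 * w + 2
  u′ = v′ + (2 * v + w + 1)
  grows : ∀ v w → 1 + (v + w) + (6 * v + 2 * w + 2) ≡ 5 * v + 2 * w + 2 + (2 * v + w + 1)
  grows = solve-∀
  step : ∀ v w →
    (5 * v + 2 * w + 2 + (2 * v + w + 1)) * (5 * v + 2 * w + 2 + (2 * v + w + 1)) + (5 * v + 2 * w + 2 + (2 * v + w + 1))
      + 2 * (v * v + v) ≡
    2 * ((5 * v + 2 * w + 2) * (5 * v + 2 * w + 2) + (5 * v + 2 * w + 2)) + ((v + w) * (v + w) + (v + w))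
  step = solve-∀

halfCore : ∀ p N → ∃[ a ] ∃[ b ] N ≤ a + b × HalfCore p a b
halfCore clique N with pell N
... | v , w , N≤ , eq = suc v , w , m≤n⇒m≤1+n N≤ , *-cancelˡ-≡ _ _ 2 (begin-equality
  2 * (suc (v + w) C 2)             ≡⟨ 2*[1+n]C2 (v + w) ⟩
  (v + w) * (v + w) + (v + w)       ≡⟨ eq ⟩
  2 * (v * v + v)                   ≡⟨ cong (2 *_) (2*[1+n]C2 v) ⟨
  2 * (2 * (suc v C 2))             ∎)
  where
  2*[1+n]C2 : ∀ n → 2 * (suc n C 2) ≡ n * n + n
  2*[1+n]C2 n = +-cancelʳ-≡ (suc n) _ _ (trans (2*nC2+n≡n*n (suc n)) (square n))
    where
    square : ∀ n → (1 + n) * (1 + n) ≡ n * n + n + (1 + n)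
    square = solve-∀
-- Here a + b = (2N + 1)², the only way for ab to be half of C(a + b, 2) being (b - a)² = a + b.
halfCore cut N = N * (2 * N + 1) , (1 + N) * (2 * N + 1) , large N ,
  *-cancelˡ-≡ _ _ 2 (+-cancelʳ-≡ (N * (2 * N + 1) + (1 + N) * (2 * N + 1)) _ _
    (trans (2*nC2+n≡n*n (N * (2 * N + 1) + (1 + N) * (2 * N + 1))) (square N)))
  where
  large : ∀ N → N ≤ N * (2 * N + 1) + (1 + N) * (2 * N + 1)
  large N = ≤-trans (m≤m+n N (4 * N * N + 3 * N + 1)) (≤-reflexive (expand N))
    where
    expand : ∀ N → N + (4 * N * N + 3 * N + 1) ≡ N * (2 * N + 1) + (1 + N) * (2 * N + 1)
    expand = solve-∀
  square : ∀ N → (N * (2 * N + 1) + (1 + N) * (2 * N + 1)) * (N * (2 * N + 1) + (1 + N) * (2 * N + 1)) ≡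
    2 * (2 * (N * (2 * N + 1) * ((1 + N) * (2 * N + 1)))) + (N * (2 * N + 1) + (1 + N) * (2 * N + 1))
  square = solve-∀

-- The core color is counted directly; the other color has the rest of a total that is twice the
-- core.
e[R]≡e[B] : ∀ p q a b → HalfCore p a b → let c = coloring {a + b} p q (threshold a) in
  e (R c) ≡ coreEdges p a b × e (B c) ≡ coreEdges p a b
e[R]≡e[B] p true  a b half = let c = coloring {a + b} p true (threshold a); red = e-color p true a b in
  red , +-cancelˡ-≡ (coreEdges p a b) _ _ (trans (cong (_+ e (B c)) (sym red))
    (trans (e[R]+e[B]≡nC2 c) (trans half (cong (coreEdges p a b +_) (+-identityʳ _)))))
e[R]≡e[B] p false a b half = let c = coloring {a + b} p false (threshold a); blue = e-color p false a b in
  +-cancelʳ-≡ (coreEdges p a b) _ _ (trans (cong (e (R c) +_) (sym blue))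
    (trans (e[R]+e[B]≡nC2 c) (trans half (cong (coreEdges p a b +_) (+-identityʳ _))))) , blue

-- The smaller color class is as large as possible here, so any non-vacuous threshold is exceeded.
balanced-coloring : ∀ p q N → ∃[ n ] N ≤ n × Σ[ σ ∈ (Fin n → Bool) ]
  (let c = coloring p q σ in e (R c) ⊓ e (B c) ≡ ⌊ n C 2 /2⌋)
balanced-coloring p q N with halfCore p N
... | a , b , N≤ , half with e[R]≡e[B] p q a b half
...   | red , blue = a + b , N≤ , threshold a , trans (cong₂ _⊓_ red blue)
  (trans (⊓-idem _) (trans (n≡⌊n+n/2⌋ (coreEdges p a b))
    (cong ⌊_/2⌋ (sym (trans half (cong (coreEdges p a b +_) (+-identityʳ _)))))))

-- Transfer of copies and the asymptotic bounds.

-- The color of an edge in a pattern depends only on the classes of its ends, so each vertex of the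
-- copy moves to its own slot in the same class.
transfer : ∀ {k n n′} (G : Graph k) (c : Coloring n) p q (σ : Fin n′ → Bool) →
  Patterns.Pattern c p q k → ∀ r b → ColoredCopy G (coloring p q σ) r b → ColoredCopy G c r b
transfer {k} {n} G c p q σ P r b copy with copy⇒embedded G (coloring p q σ) copy
... | φ , φ-inj , red , blue = embedded⇒copy G c (ψ , ψ-inj ,
    trans (e-cong (G ∩ pullback ψ (R c)) (G ∩ pullback φ (R c′)) (same (R c) (R c′) R-agrees)) red ,
    trans (e-cong (G ∩ pullback ψ (B c)) (G ∩ pullback φ (B c′)) (same (B c) (B c′) B-agrees)) blue)
  where
  open Patterns c
  open Pattern P
  c′ = coloring p q σ
  ψ : Fin k → Fin n
  ψ u = place (σ (φ u)) u
  ψ-adj : ∀ {u v} → u ≢ v → E (paint p q (σ (φ u)) (σ (φ v))) (ψ u) (ψ v)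
  ψ-adj {u} {v} = place-adj (σ (φ u)) (σ (φ v))
  ψ-inj : Injective _≡_ _≡_ ψ
  ψ-inj {u} {v} eq with u Fin.≟ v
  ... | yes u≡v = u≡v
  -- Distinct vertices are sent to vertices adjacent in some color, hence to distinct ones.
  ... | no  u≢v = ⊥-elim (E⇒≢ _ (ψ-adj u≢v) eq)
  E⇒red : ∀ x {i j} → i ≢ j → E x i j → adj (R c) i j ≡ x
  E⇒red true  _   Rij = Equivalence.to T-≡ Rij
  E⇒red false {i} {j} i≢j Bij = not-injective (trans (sym (partition c i j i≢j)) (Equivalence.to T-≡ Bij))
  R-agrees : ∀ u v → u ≢ v → adj (R c) (ψ u) (ψ v) ≡ adj (R c′) (φ u) (φ v)
  R-agrees u v u≢v = trans (E⇒red _ (u≢v ∘ ψ-inj) (ψ-adj u≢v))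
    (sym (cong (λ d → not d ∧ paint p q (σ (φ u)) (σ (φ v))) (dec-false (φ u Fin.≟ φ v) (u≢v ∘ φ-inj))))
  B-agrees : ∀ u v → u ≢ v → adj (B c) (ψ u) (ψ v) ≡ adj (B c′) (φ u) (φ v)
  B-agrees u v u≢v = trans (partition c _ _ (u≢v ∘ ψ-inj))
    (trans (cong not (R-agrees u v u≢v)) (sym (partition c′ _ _ (u≢v ∘ φ-inj))))
  same : ∀ H H′ → (∀ u v → u ≢ v → adj H (ψ u) (ψ v) ≡ adj H′ (φ u) (φ v)) →
    ∀ u v → adj (G ∩ pullback ψ H) u v ≡ adj (G ∩ pullback φ H′) u v
  same H H′ agrees u v with u Fin.≟ v
  ... | yes refl rewrite adj-irrefl G u = refl
  ... | no  u≢v  = cong (adj G u v ∧_) (agrees u v u≢v)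

-- The common feature of the three parameters: the forced property passes to any coloring with at
-- least the same colored copies of `G`.
CopyInvariant : ∀ {k} → Graph k → (∀ {n} → Coloring n → Set) → Set
CopyInvariant G Q = ∀ {n n′} (c′ : Coloring n′) (c : Coloring n) →
  (∀ r b → ColoredCopy G c′ r b → ColoredCopy G c r b) → Q c′ → Q c

-- A minimum s with s^m above the bound would be contradicted by s - 1:
-- colorings with more than s - 1 edges of each color still contain a pattern.
eventually-bounded : ∀ {k} (G : Graph k) (Q : ∀ {n} → Coloring n → Set) → CopyInvariant G Q →
  EventuallyNonVacuous (λ n → IsMinimum (Forces n Q)) → O[n^2-1/ bicliqueSize k ] (λ n → IsMinimum (Forces n Q))
eventually-bounded {k} G Q invariant (N , nonvacuous) = 2 * t , suc N , λ n N<n →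
  let s , minimum , _ = nonvacuous n (<⇒≤ N<n) in s , minimum , small (<-≤-trans z<s N<n) s minimum
  where
  t = bicliqueSize k
  instance
    t≢0 : NonZero t
    t≢0 = m^n≢0 2 (cliqueSize k + cliqueSize k)
  pattern⇒Q : ∀ {n} (c : Coloring n) → Patterns.Unavoidable c k → Q c
  -- The hypothesis is applied at the order n′ of a balanced pattern: both of its color classes
  -- exceed the minimum there, so it satisfies `Q`.
  pattern⇒Q c (p , q , P) with balanced-coloring p q N
  ... | n′ , N≤n′ , σ , balanced with nonvacuous n′ N≤n′
  ...   | s , (forces , _) , s< = invariant (coloring p q σ) c (transfer G c p q σ P)
    (forces (coloring p q σ) (<-≤-trans s< (≤-reflexive (sym balanced))))
  small : ∀ {n} → 0 < n → ∀ s → IsMinimum (Forces n Q) s → s ^ t ≤ (2 * t) ^ t * n ^ (2 * t ∸ 1)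
  small {n} 0<n s (_ , least) with s ^ t ≤? (2 * t) ^ t * n ^ (2 * t ∸ 1)
  ... | yes s^t≤ = s^t≤
  small {n} 0<n zero    _           | no 0^t≰ = ⊥-elim (0^t≰ (≤-trans (≤-reflexive (0^n≡0 t)) z≤n))
    where
    0^n≡0 : ∀ n .{{_ : NonZero n}} → 0 ^ n ≡ 0
    0^n≡0 (suc n) = refl
  small {n} 0<n (suc s) (_ , least) | no s^t≰ = ⊥-elim (1+n≰n (least s λ c s< →
    pattern⇒Q c (Patterns.unavoidable c k 0<n λ q →
      <-≤-trans (≰⇒> s^t≰) (^-monoˡ-≤ t (≤-trans s< (min≤ c q))))))
    where
    min≤ : ∀ c q → e (R c) ⊓ e (B c) ≤ e (color c q)
    min≤ c true  = m⊓n≤m _ _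
    min≤ c false = m⊓n≤n _ _

corollary2p7 : ∀ {k} (G : Graph k) →
    (∃[ m ] 0 < m
    × (∀ r → 0 < r → r ≤ ⌊ e G /2⌋ → Tonal r G → O[n^2-1/ m ] (Balᵣ r G))
    × (Balanceable G → O[n^2-1/ m ] (Bal G)))
    × (∃[ m ] 0 < m × (Omnitonal G → O[n^2-1/ m ] (Ot G)))
corollary2p7 {k} G =
  -- The exponent depends only on the number of vertices of `G`, so one value serves all r and all
  -- three parameters.
  (bicliqueSize k , m>0 ,
    (λ r _ _ → eventually-bounded G (λ c → ColoredCopy G c r (e G ∸ r) ⊎ ColoredCopy G c (e G ∸ r) r)
      λ _ _ copies → Sum.map (copies _ _) (copies _ _)) ,
    eventually-bounded G (λ c → ColoredCopy G c ⌈ e G /2⌉ ⌊ e G /2⌋ ⊎ ColoredCopy G c ⌊ e G /2⌋ ⌈ e G /2⌉)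
      λ _ _ copies → Sum.map (copies _ _) (copies _ _)) ,
  bicliqueSize k , m>0 ,
    eventually-bounded G (λ c → ∀ r b → r + b ≡ e G → ColoredCopy G c r b)
      λ _ _ copies all r b r+b≡e → copies r b (all r b r+b≡e)
  where
  m>0 : 0 < bicliqueSize k
  m>0 = m^n>0 2 (cliqueSize k + cliqueSize k)
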